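{- Let $r,s$ be coprime positive integers with $2\mid s$ and $1\le s<r/2$. Let $\Delta_1=s(r-s)(r+s)$ and define $p_{3,s}(n)$ by $$\sum_{n=0}^\infty p_{3,s}(n)q^n=\frac{1}{(1-q^s)(1-q^{r-s})(1-q^{r+s})}.$$ Then for all integers $n\ge 0$, $$P_{2,s}(n)+C^{d}_{3,s}\ \le\ p_{3,s}(n)\ \le\ P_{2,s}(n)+C^{u}_{3,s},$$ where $$\begin{aligned} P_{2,s}(n)&=\frac{1}{2\Delta_1}\left(n^2+2nr+ns+2r+s-1\right),\\ C^{u}_{3,s}&=\frac{1}{2\Delta_1}\Big(r^3(2s^2-s)+r^2(2s-2s^3)+r(-2s^4+s^3-2s-1)+2s^5-2s^3+2s^2-s+1\Big),\\ C^{d}_{3,s}&=\frac{1}{2\Delta_1}\Big(r^3(-2s^2-s)+2r^2s^3+r(2s^4+s^3+2s-1)-2s^5-2s^2-s+1\Big). \end{aligned}$$ -}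

module Defs where

open import Data.Nat.Base as ℕ using (ℕ; NonZero; >-nonZero)
import Data.Nat.Properties as ℕ
open import Data.Integer.Base using (ℤ; +_; 0ℤ; 1ℤ; _+_; _-_; _*_; -_; _^_)
import Data.Integer.Properties as ℤ
open import Data.Rational.Base using (ℚ; _/_)
open import Data.Fin.Base using (Fin; toℕ)
open import Data.Bool.Base using (if_then_else_)
open import Relation.Binary.PropositionalEquality using (_≡_)
open import Algebra.Bundles using (CommutativeRing)
open import Algebra.Properties.Semiring.Sum (CommutativeRing.semiring ℤ.+-*-commutativeRing) using (sum)

-- Formal power series in q over ℤ: f stands for Σₙ f(n) qⁿ.
PowerSeries : Set
PowerSeries = ℕ → ℤ

q^_ : ℕ → PowerSeries
(q^ k) n = if n ℕ.≡ᵇ k then 1ℤ else 0ℤ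

𝟙 : PowerSeries
𝟙 = q^ 0

infixl 6 _⊖_
_⊖_ : PowerSeries → PowerSeries → PowerSeries
(f ⊖ g) n = f n - g n

-- The Cauchy product.
infixl 7 _⊛_
_⊛_ : PowerSeries → PowerSeries → PowerSeries
(f ⊛ g) n = sum λ (k : Fin (ℕ.suc n)) → f (toℕ k) * g (n ℕ.∸ toℕ k)

-- g = 1/f in ℤ⟦q⟧; ℤ⟦q⟧ is commutative, so g is uniquely determined by f.
infix 4 _≗1/_
_≗1/_ : PowerSeries → PowerSeries → Set
g ≗1/ f = ∀ n → (f ⊛ g) n ≡ 𝟙 n

-- The truncated subtraction below is the true one, since s < r wherever
-- these definitions are used.

denominator : ℕ → ℕ → PowerSeries
denominator r s = (𝟙 ⊖ q^ s) ⊛ (𝟙 ⊖ q^ (r ℕ.∸ s)) ⊛ (𝟙 ⊖ q^ (r ℕ.+ s))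

Δ₁ : ℕ → ℕ → ℕ
Δ₁ r s = s ℕ.* (r ℕ.∸ s) ℕ.* (r ℕ.+ s)

Δ₁-nonZero : ∀ {r s} → 1 ℕ.≤ s → 2 ℕ.* s ℕ.< r → NonZero (Δ₁ r s)
Δ₁-nonZero {r} {s} 1≤s 2s<r =
  ℕ.m*n≢0 (s ℕ.* (r ℕ.∸ s)) (r ℕ.+ s)
    {{ℕ.m*n≢0 s (r ℕ.∸ s) {{>-nonZero 1≤s}} {{>-nonZero (ℕ.m<n⇒0<n∸m s<r)}}}}
    {{>-nonZero (ℕ.≤-trans 1≤s (ℕ.m≤n+m s r))}}
  where
  s<r : s ℕ.< r
  s<r = ℕ.≤-<-trans (ℕ.m≤m+n s (s ℕ.+ 0)) 2s<r

infixl 7 _/2Δ₁[_,_]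
_/2Δ₁[_,_] : ℤ → (r s : ℕ) → .{{NonZero (Δ₁ r s)}} → ℚ
a /2Δ₁[ r , s ] = _/_ a (2 ℕ.* Δ₁ r s) {{ℕ.m*n≢0 2 (Δ₁ r s)}}

P₂-numerator : (r s n : ℤ) → ℤ
P₂-numerator r s n = n ^ 2 + + 2 * n * r + n * s + + 2 * r + s - + 1

Cᵘ₃-numerator : (r s : ℤ) → ℤ
Cᵘ₃-numerator r s =
    r ^ 3 * (+ 2 * s ^ 2 - s)
  + r ^ 2 * (+ 2 * s - + 2 * s ^ 3)
  + r * (- (+ 2 * s ^ 4) + s ^ 3 - + 2 * s - + 1)
  + + 2 * s ^ 5 - + 2 * s ^ 3 + + 2 * s ^ 2 - s + + 1

Cᵈ₃-numerator : (r s : ℤ) → ℤ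
Cᵈ₃-numerator r s =
    r ^ 3 * (- (+ 2 * s ^ 2) - s)
  + + 2 * r ^ 2 * s ^ 3
  + r * (+ 2 * s ^ 4 + s ^ 3 + + 2 * s - + 1)
  - + 2 * s ^ 5 - + 2 * s ^ 2 - s + + 1

module _ (r s : ℕ) .{{_ : NonZero (Δ₁ r s)}} where

  P₂ : ℕ → ℚ
  P₂ n = P₂-numerator (+ r) (+ s) (+ n) /2Δ₁[ r , s ]

  Cᵘ₃ : ℚ
  Cᵘ₃ = Cᵘ₃-numerator (+ r) (+ s) /2Δ₁[ r , s ]

  Cᵈ₃ : ℚ
  Cᵈ₃ = Cᵈ₃-numerator (+ r) (+ s) /2Δ₁[ r , s ]

-- With a = s, b = r - s and c = r + s, which are pairwise coprime, the number
-- p₂(n) of solutions of n = ax + by is given by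
--   2ab p₂(n) = 2n + a + b + E(n),  E(n) = b φ_a(b′n) + a φ_b(a′n),
-- where b′ and a′ invert b modulo a and a modulo b, and φ_M(x) = M - 1 - 2 (x mod M).
-- Summing over the number of parts c, the main terms telescope to a quadratic
-- polynomial in n, up to a term depending only on n mod c. The sum of E over any
-- ab consecutive terms of a progression with step c vanishes, so at most ab - 1
-- error terms remain, each bounded by 2ab - a - b in absolute value.

{-# OPTIONS --safe #-}
module Submission where

open import Defs
open import Algebra.Bundles using (CommutativeRing)
open import Data.Fin.Base using (Fin; toℕ)
open import Data.Fin.Properties using (toℕ<n)
open import Data.Integer.Base as ℤ using (ℤ; +_; 0ℤ; 1ℤ)
import Data.Integer.Properties as ℤ
import Data.Integer.Tactic.RingSolver as ℤ-Solver
open import Data.Nat.Base as ℕ using (ℕ; zero; suc; s≤s; z≤n; NonZero; >-nonZero)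
open import Data.Nat.Coprimality using (Coprime; coprime-Bézout; coprime-divisor)
open import Data.Nat.Divisibility using (_∣_; m∣m*n; ∣m+n∣m⇒∣n; ∣m∸n∣n⇒∣m; ∣m∣n⇒∣m+n; ∣-trans; >⇒∤; n∣m⇒m%n≡0; m%n≡0⇒n∣m)
open import Data.Nat.DivMod using (m≡m%n+[m/n]*n; m%n<n; m<n⇒m%n≡m; [m+kn]%n≡m%n)
open import Data.Nat.GCD using (module Bézout)
import Data.Nat.Properties as ℕ
import Data.Nat.Tactic.RingSolver as ℕ-Solver
open import Data.Product.Base using (_×_; _,_; ∃-syntax; proj₁; proj₂)
import Data.Rational.Properties as ℚ
open import Data.Rational.Unnormalised.Base as ℚᵘ using (mkℚᵘ; *≤*)
import Data.Rational.Unnormalised.Properties as ℚᵘ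
open import Data.Sum.Base using (inj₁; inj₂)
open import Function.Base using (_∘_)
open import Relation.Binary.PropositionalEquality
open import Relation.Nullary.Negation using (¬_; contradiction)
open import Algebra.Properties.Group (CommutativeRing.+-group ℤ.+-*-commutativeRing) using () renaming (∙-cancelˡ to +-cancelˡ)
open import Algebra.Properties.Semiring.Sum (CommutativeRing.semiring ℤ.+-*-commutativeRing) using (sum; sum-cong-≗; ∑-distrib-+; ∑-comm; *-distribˡ-sum; sum-replicate-zero)

-- The formula for p₂ comes from a normal form: n + ab = bu + av + abK with u < a and v < b, where u
-- is b′n modulo a and v is a′n modulo b. The coefficient K turns out to be the number of solutions,
-- so solving for it yields the main term and the error E together. The errors cancel because each
-- half of E is a mean-zero function of a residue. When n advances by c, the argument modulo a
-- advances by b′c, which is a unit, so that a steps meet every residue once; likewise modulo b.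
-- This is where c has to be coprime to a and b, and the parity of s excludes the common factor 2 of
-- r - s and r + s. As for the constants, the accumulated error is at most cW with W = (ab - 1)(2ab
-- - a - b). As a polynomial in r, cW has the cubic coefficient 2s² - s, the one in the numerator of
-- `Cᵘ₃`, so the upper estimate has a slack only quadratic in r. The numerator of `Cᵈ₃` has -2s² - s
-- in place of -2s² + s, which leaves a slack with leading term 2sr³ below.

-- Multiplication by `1 - q^k` as a difference operator

shift : ℕ → PowerSeries → PowerSeries
shift zero    f n       = f n
shift (suc k) f zero    = 0ℤ
shift (suc k) f (suc n) = shift k f n

-- Multiplication by `1 - q^k`. An equation `δ k f ≗ g` is the recurrence `f n = f (n - k) + g n`,
-- the form in which division by the factor is used below.
δ : ℕ → PowerSeries → PowerSeries
δ k f = f ⊖ shift k f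

shift-< : ∀ {k n} f → n ℕ.< k → shift k f n ≡ 0ℤ
shift-< {suc k} {zero}  f _         = refl
shift-< {suc k} {suc n} f (s≤s n<k) = shift-< f n<k

shift-+ : ∀ k f n → shift k f (k ℕ.+ n) ≡ f n
shift-+ zero    f n = refl
shift-+ (suc k) f n = shift-+ k f n

shift-cong : ∀ k {f g} → f ≗ g → shift k f ≗ shift k g
shift-cong zero    f≗g n       = f≗g n
shift-cong (suc k) f≗g zero    = refl
shift-cong (suc k) f≗g (suc n) = shift-cong k f≗g n

δ-cong : ∀ k {f g} → f ≗ g → δ k f ≗ δ k g
δ-cong k f≗g n = cong₂ ℤ._-_ (f≗g n) (shift-cong k f≗g n)

δ-< : ∀ {k n} f → n ℕ.< k → f n ≡ δ k f n
δ-< {k} {n} f n<k = sym (trans (cong (λ x → f n ℤ.- x) (shift-< f n<k)) (ℤ.+-identityʳ (f n)))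

δ-+ : ∀ k f n → f (k ℕ.+ n) ≡ f n ℤ.+ δ k f (k ℕ.+ n)
δ-+ k f n = trans (lemma (f (k ℕ.+ n)) (f n))
  (cong (λ x → f n ℤ.+ (f (k ℕ.+ n) ℤ.- x)) (sym (shift-+ k f n)))
  where
  lemma : ∀ x y → x ≡ y ℤ.+ (x ℤ.- y)
  lemma = ℤ-Solver.solve-∀

q^≗shift : ∀ k → q^ k ≗ shift k 𝟙
q^≗shift zero    n       = refl
q^≗shift (suc k) zero    = refl
q^≗shift (suc k) (suc n) = q^≗shift k n

⊛-congʳ : ∀ {f g} h → f ≗ g → f ⊛ h ≗ g ⊛ h
⊛-congʳ h f≗g n = sum-cong-≗ λ (k : Fin (suc n)) → cong (ℤ._* h (n ℕ.∸ toℕ k)) (f≗g (toℕ k))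

⊛-distribʳ-⊖ : ∀ h f g → (f ⊖ g) ⊛ h ≗ (f ⊛ h) ⊖ (g ⊛ h)
⊛-distribʳ-⊖ h f g n = begin
  sum (λ k → (F k ℤ.- G k) ℤ.* H k)
    ≡⟨ sum-cong-≗ (λ k → lemma₁ (F k) (G k) (H k)) ⟩
  sum (λ k → F k ℤ.* H k ℤ.+ ℤ.-1ℤ ℤ.* (G k ℤ.* H k))
    ≡⟨ ∑-distrib-+ (λ k → F k ℤ.* H k) (λ k → ℤ.-1ℤ ℤ.* (G k ℤ.* H k)) ⟩
  (f ⊛ h) n ℤ.+ sum (λ k → ℤ.-1ℤ ℤ.* (G k ℤ.* H k))
    ≡⟨ cong (λ x → (f ⊛ h) n ℤ.+ x) (*-distribˡ-sum ℤ.-1ℤ (λ k → G k ℤ.* H k)) ⟨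
  (f ⊛ h) n ℤ.+ ℤ.-1ℤ ℤ.* (g ⊛ h) n
    ≡⟨ cong (λ x → (f ⊛ h) n ℤ.+ x) (ℤ.-1*i≡-i ((g ⊛ h) n)) ⟩
  (f ⊛ h) n ℤ.- (g ⊛ h) n ∎
  where
  open ≡-Reasoning
  F G H : Fin (suc n) → ℤ
  F = f ∘ toℕ
  G = g ∘ toℕ
  H k = h (n ℕ.∸ toℕ k)
  lemma₁ : ∀ x y z → (x ℤ.- y) ℤ.* z ≡ x ℤ.* z ℤ.+ ℤ.-1ℤ ℤ.* (y ℤ.* z)
  lemma₁ = ℤ-Solver.solve-∀

shift-⊛ : ∀ k f h → shift k f ⊛ h ≗ shift k (f ⊛ h)
shift-⊛ zero    f h n       = refl
shift-⊛ (suc k) f h zero    = refl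
shift-⊛ (suc k) f h (suc n) = trans (ℤ.+-identityˡ _) (shift-⊛ k f h n)

δ-⊛ : ∀ k f h → δ k f ⊛ h ≗ δ k (f ⊛ h)
δ-⊛ k f h n = trans (⊛-distribʳ-⊖ h f (shift k f) n) (cong (λ x → (f ⊛ h) n ℤ.- x) (shift-⊛ k f h n))

⊛-identityˡ : ∀ h → 𝟙 ⊛ h ≗ h
⊛-identityˡ h n = trans (cong₂ ℤ._+_ (ℤ.*-identityˡ (h n)) (sum-replicate-zero n)) (ℤ.+-identityʳ (h n))

1-q^-⊛ : ∀ k h → (𝟙 ⊖ q^ k) ⊛ h ≗ δ k h
1-q^-⊛ k h n = begin
  ((𝟙 ⊖ q^ k) ⊛ h) n  ≡⟨ ⊛-congʳ h (λ m → cong (λ x → 𝟙 m ℤ.- x) (q^≗shift k m)) n ⟩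
  (δ k 𝟙 ⊛ h) n       ≡⟨ δ-⊛ k 𝟙 h n ⟩
  δ k (𝟙 ⊛ h) n       ≡⟨ δ-cong k (⊛-identityˡ h) n ⟩
  δ k h n             ∎
  where open ≡-Reasoning

-- The product is nested to the left, so each factor in turn becomes a `δ` at the left end and is
-- then pulled out of the remaining product by `δ-⊛`.
denominator-⊛ : ∀ a b c h → (𝟙 ⊖ q^ a) ⊛ (𝟙 ⊖ q^ b) ⊛ (𝟙 ⊖ q^ c) ⊛ h ≗ δ a (δ b (δ c h))
denominator-⊛ a b c h n = begin
  (A ⊛ B ⊛ C ⊛ h) n      ≡⟨ ⊛-congʳ h (⊛-congʳ C (1-q^-⊛ a B)) n ⟩
  (δ a B ⊛ C ⊛ h) n      ≡⟨ ⊛-congʳ h (δ-⊛ a B C) n ⟩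
  (δ a (B ⊛ C) ⊛ h) n    ≡⟨ δ-⊛ a (B ⊛ C) h n ⟩
  δ a (B ⊛ C ⊛ h) n      ≡⟨ δ-cong a (⊛-congʳ h (1-q^-⊛ b C)) n ⟩
  δ a (δ b C ⊛ h) n      ≡⟨ δ-cong a (δ-⊛ b C h) n ⟩
  δ a (δ b (C ⊛ h)) n    ≡⟨ δ-cong a (δ-cong b (1-q^-⊛ c h)) n ⟩
  δ a (δ b (δ c h)) n    ∎
  where
  open ≡-Reasoning
  A B C : PowerSeries
  A = 𝟙 ⊖ q^ a
  B = 𝟙 ⊖ q^ b
  C = 𝟙 ⊖ q^ c

module _ where
  open import Data.Nat.Base using (_+_; _*_; _∸_; _≤_; _<_; _/_; _%_)

  -- Partitions into one and two parts

  module _ {a} .{{a≢0 : NonZero a}} {p₁ : PowerSeries} (δp₁ : δ a p₁ ≗ 𝟙) where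

    p₁-residue : ∀ q {r} → r < a → p₁ (q * a + r) ≡ 𝟙 r
    p₁-residue zero    {r} r<a = trans (δ-< p₁ r<a) (δp₁ r)
    p₁-residue (suc q) {r} r<a = begin
      p₁ (a + q * a + r)                                  ≡⟨ cong p₁ (ℕ.+-assoc a (q * a) r) ⟩
      p₁ (a + (q * a + r))                                ≡⟨ δ-+ a p₁ (q * a + r) ⟩
      p₁ (q * a + r) ℤ.+ δ a p₁ (a + (q * a + r))         ≡⟨ cong₂ ℤ._+_ (p₁-residue q r<a) (δp₁ (a + (q * a + r))) ⟩
      𝟙 r ℤ.+ 𝟙 (a + (q * a + r))                         ≡⟨ cong (λ x → 𝟙 r ℤ.+ x) (𝟙≡0 a) ⟩
      𝟙 r ℤ.+ 0ℤ                                          ≡⟨ ℤ.+-identityʳ (𝟙 r) ⟩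
      𝟙 r                                                 ∎
      where
      open ≡-Reasoning
      𝟙≡0 : ∀ k .{{_ : NonZero k}} {m} → 𝟙 (k + m) ≡ 0ℤ
      𝟙≡0 (suc _) = refl

    p₁≡𝟙% : ∀ n → p₁ n ≡ 𝟙 (n % a)
    p₁≡𝟙% n = trans
      (cong p₁ (trans (m≡m%n+[m/n]*n n a) (ℕ.+-comm (n % a) _)))
      (p₁-residue (n / a) (m%n<n n a))

    p₁-∣ : ∀ {n} → a ∣ n → p₁ n ≡ 1ℤ
    p₁-∣ {n} a∣n = trans (p₁≡𝟙% n) (cong 𝟙 (n∣m⇒m%n≡0 n a a∣n))

    p₁-∤ : ∀ {n} → ¬ (a ∣ n) → p₁ n ≡ 0ℤ
    p₁-∤ {n} a∤n with n % a in eq | p₁≡𝟙% n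
    ... | zero  | _     = contradiction (m%n≡0⇒n∣m n a eq) a∤n
    ... | suc _ | p₁n≡0 = p₁n≡0

    module _ {b} .{{b≢0 : NonZero b}} (a⊥b : Coprime a b) (p₂ : PowerSeries) (δp₂ : δ b p₂ ≗ p₁) where

      private
        a∣n : ∀ {n} v K → n + a * b ≡ b * 0 + a * v + a * b * K → a ∣ n
        a∣n {n} v K eq = ∣m+n∣m⇒∣n
          (subst (a ∣_) (trans (rearrange a b v K) (trans (sym eq) (ℕ.+-comm n (a * b)))) (m∣m*n (v + b * K)))
          (m∣m*n b)
          where
          rearrange : ∀ a b v K → a * (v + b * K) ≡ b * 0 + a * v + a * b * K
          rearrange = ℕ-Solver.solve-∀

        -- Modulo `a` the equation reads `n ≡ b * suc u`; here `b` is a unit and `0 < suc u < a`.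
        a∤n : ∀ {n} u v K → suc u < a → n + a * b ≡ b * suc u + a * v + a * b * K → ¬ (a ∣ n)
        a∤n {n} u v K u<a eq a∣n = >⇒∤ u<a (coprime-divisor a⊥b
          (∣m+n∣m⇒∣n
            (subst (a ∣_) (trans eq (rearrange a b u v K)) (∣m∣n⇒∣m+n a∣n (m∣m*n b)))
            (m∣m*n (v + b * K))))
          where
          rearrange : ∀ a b u v K → b * suc u + a * v + a * b * K ≡ a * (v + b * K) + b * suc u
          rearrange = ℕ-Solver.solve-∀

        K≢0 : ∀ {n v} → v < b → n + a * b ≢ b * 0 + a * v + a * b * 0
        K≢0 {n} {v} v<b eq = ℕ.<⇒≱ (ℕ.*-monoʳ-< a v<b) (begin
          a * b                        ≤⟨ ℕ.m≤n+m (a * b) n ⟩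
          n + a * b                    ≡⟨ eq ⟩
          b * 0 + a * v + a * b * 0    ≡⟨ rearrange a b v ⟩
          a * v                        ∎)
          where
          open ℕ.≤-Reasoning
          rearrange : ∀ a b v → b * 0 + a * v + a * b * 0 ≡ a * v
          rearrange = ℕ-Solver.solve-∀

      -- n + ab = bu + av + abK with u < a and v < b determines K, and K counts
      -- the solutions of n = ax + by: they are y = u, u + a, …, u + (K-1)a.
      p₂-residue : ∀ q {r} → r < b → ∀ {u v} K → u < a → v < b →
        q * b + r + a * b ≡ b * u + a * v + a * b * K → p₂ (q * b + r) ≡ + K
      -- For `n = r < b` the count is `p₁ r`, and size leaves only two cases, `u = 0` with `K = 1`
      -- and `u > 0` with `K = 0`. For `u = K = 0` the right side `a * v` is below `a * b`; in all
      -- other cases it is at least `b + a * b`, which exceeds `r + a * b`.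
      p₂-residue zero {r} r<b {zero} zero u<a v<b eq = contradiction eq (K≢0 v<b)
      p₂-residue zero {r} r<b {zero} {v} (suc zero) u<a v<b eq =
        trans (δ-< p₂ r<b) (trans (δp₂ r) (p₁-∣ (a∣n v 1 eq)))
      p₂-residue zero {r} r<b {zero} {v} (suc (suc K)) u<a v<b eq =
        contradiction (ℕ.+-monoˡ-< (a * b) r<b) (ℕ.≤⇒≯ (begin
          b + a * b                                  ≤⟨ ℕ.+-monoˡ-≤ (a * b) (ℕ.m≤n*m b a) ⟩
          a * b + a * b                              ≤⟨ ℕ.m≤m+n _ (a * v + a * b * K) ⟩
          a * b + a * b + (a * v + a * b * K)        ≡⟨ rearrange a b v K ⟩
          b * 0 + a * v + a * b * suc (suc K)        ≡⟨ eq ⟨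
          r + a * b                                  ∎))
        where
        open ℕ.≤-Reasoning
        rearrange : ∀ a b v K → a * b + a * b + (a * v + a * b * K) ≡ b * 0 + a * v + a * b * suc (suc K)
        rearrange = ℕ-Solver.solve-∀
      p₂-residue zero {r} r<b {suc u} {v} zero u<a v<b eq =
        trans (δ-< p₂ r<b) (trans (δp₂ r) (p₁-∤ (a∤n u v 0 u<a eq)))
      p₂-residue zero {r} r<b {suc u} {v} (suc K) u<a v<b eq =
        contradiction (ℕ.+-monoˡ-< (a * b) r<b) (ℕ.≤⇒≯ (begin
          b + a * b                                  ≤⟨ ℕ.m≤m+n _ (b * u + a * v + a * b * K) ⟩
          b + a * b + (b * u + a * v + a * b * K)    ≡⟨ rearrange a b u v K ⟩
          b * suc u + a * v + a * b * suc K          ≡⟨ eq ⟨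
          r + a * b                                  ∎))
        where
        open ℕ.≤-Reasoning
        rearrange : ∀ a b u v K → b + a * b + (b * u + a * v + a * b * K) ≡ b * suc u + a * v + a * b * suc K
        rearrange = ℕ-Solver.solve-∀
      p₂-residue (suc q) {r} r<b {zero} zero u<a v<b eq = contradiction eq (K≢0 v<b)
      -- Taking `b` from `n` normally lowers `u` by one. At `u = 0` it borrows `b * a` from the last
      -- term instead: `u` wraps around to `a - 1` and `K` drops by one, which accounts for the
      -- solution with `y = 0`.
      p₂-residue (suc q) {r} r<b {zero} {v} (suc K) u<a v<b eq = begin
        p₂ (b + q * b + r)                               ≡⟨ cong p₂ (ℕ.+-assoc b (q * b) r) ⟩
        p₂ (b + (q * b + r))                             ≡⟨ δ-+ b p₂ (q * b + r) ⟩
        p₂ (q * b + r) ℤ.+ δ b p₂ (b + (q * b + r))      ≡⟨ cong₂ ℤ._+_ IH (trans (δp₂ _) (p₁-∣ a∣)) ⟩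
        + K ℤ.+ 1ℤ                                       ≡⟨ cong +_ (ℕ.+-comm K 1) ⟩
        + suc K                                          ∎
        where
        open ≡-Reasoning
        a∣ : a ∣ b + (q * b + r)
        a∣ = subst (a ∣_) (ℕ.+-assoc b (q * b) r) (a∣n v (suc K) eq)
        a≡ : a ≡ suc (ℕ.pred a)
        a≡ = sym (ℕ.suc-pred a)
        step : ∀ a b v K → b * 0 + suc a * v + suc a * b * suc K ≡ b + (b * a + suc a * v + suc a * b * K)
        step = ℕ-Solver.solve-∀
        IH : p₂ (q * b + r) ≡ + K
        IH = p₂-residue q r<b K (subst (ℕ.pred a <_) (sym a≡) ℕ.≤-refl) v<b (ℕ.+-cancelˡ-≡ b _ _ (begin
          b + (q * b + r + a * b)                        ≡⟨ assoc b (q * b) r (a * b) ⟩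
          b + q * b + r + a * b                          ≡⟨ eq ⟩
          b * 0 + a * v + a * b * suc K                  ≡⟨ subst (λ x → b * 0 + x * v + x * b * suc K ≡ b + (b * ℕ.pred a + x * v + x * b * K)) (sym a≡) (step (ℕ.pred a) b v K) ⟩
          b + (b * ℕ.pred a + a * v + a * b * K)         ∎))
          where
          assoc : ∀ w x y z → w + (x + y + z) ≡ w + x + y + z
          assoc = ℕ-Solver.solve-∀
      p₂-residue (suc q) {r} r<b {suc u} {v} K u<a v<b eq = begin
        p₂ (b + q * b + r)                               ≡⟨ cong p₂ (ℕ.+-assoc b (q * b) r) ⟩
        p₂ (b + (q * b + r))                             ≡⟨ δ-+ b p₂ (q * b + r) ⟩
        p₂ (q * b + r) ℤ.+ δ b p₂ (b + (q * b + r))      ≡⟨ cong₂ ℤ._+_ IH (trans (δp₂ _) (p₁-∤ a∤)) ⟩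
        + K ℤ.+ 0ℤ                                       ≡⟨ ℤ.+-identityʳ (+ K) ⟩
        + K                                              ∎
        where
        open ≡-Reasoning
        a∤ : ¬ (a ∣ b + (q * b + r))
        a∤ = subst (λ x → ¬ (a ∣ x)) (ℕ.+-assoc b (q * b) r) (a∤n u v K u<a eq)
        assoc : ∀ w x y z → w + (x + y + z) ≡ w + x + y + z
        assoc = ℕ-Solver.solve-∀
        step : ∀ a b u v K → b * suc u + a * v + a * b * K ≡ b + (b * u + a * v + a * b * K)
        step = ℕ-Solver.solve-∀
        IH : p₂ (q * b + r) ≡ + K
        IH = p₂-residue q r<b K (ℕ.<-trans ℕ.≤-refl u<a) v<b (ℕ.+-cancelˡ-≡ b _ _
          (trans (assoc b (q * b) r (a * b)) (trans eq (step a b u v K))))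

      p₂-count : ∀ n {u v} K → u < a → v < b → n + a * b ≡ b * u + a * v + a * b * K → p₂ n ≡ + K
      p₂-count n {u} {v} K u<a v<b eq = trans (cong p₂ n≡)
        (p₂-residue (n / b) (m%n<n n b) K u<a v<b
          (subst (λ x → x + a * b ≡ b * u + a * v + a * b * K) n≡ eq))
        where
        n≡ : n ≡ n / b * b + n % b
        n≡ = trans (m≡m%n+[m/n]*n n b) (ℕ.+-comm (n % b) _)

  -- Sums over arithmetic progressions

  ∑< : ℕ → (ℕ → ℤ) → ℤ
  ∑< n f = sum λ (i : Fin n) → f (toℕ i)

  ∑<-cong : ∀ n {f g} → (∀ i → i < n → f i ≡ g i) → ∑< n f ≡ ∑< n g
  ∑<-cong n f≡g = sum-cong-≗ λ i → f≡g (toℕ i) (toℕ<n i)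

  ∑<-zero : ∀ n {f} → (∀ i → i < n → f i ≡ 0ℤ) → ∑< n f ≡ 0ℤ
  ∑<-zero n f≡0 = trans (∑<-cong n f≡0) (sum-replicate-zero n)

  ∑<-++ : ∀ m n f → ∑< (m + n) f ≡ ∑< m f ℤ.+ ∑< n (λ i → f (m + i))
  ∑<-++ zero    n f = sym (ℤ.+-identityˡ _)
  ∑<-++ (suc m) n f = trans (cong (λ x → f 0 ℤ.+ x) (∑<-++ m n (f ∘ suc))) (sym (ℤ.+-assoc (f 0) _ _))

  ∑<-suc : ∀ n f → ∑< (suc n) f ≡ ∑< n f ℤ.+ f n
  ∑<-suc n f = begin
    ∑< (suc n) f                   ≡⟨ cong (λ m → ∑< m f) (ℕ.+-comm 1 n) ⟩
    ∑< (n + 1) f                   ≡⟨ ∑<-++ n 1 f ⟩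
    ∑< n f ℤ.+ (f (n + 0) ℤ.+ 0ℤ)  ≡⟨ cong (λ x → ∑< n f ℤ.+ x) (ℤ.+-identityʳ _) ⟩
    ∑< n f ℤ.+ f (n + 0)           ≡⟨ cong (λ m → ∑< n f ℤ.+ f m) (ℕ.+-identityʳ n) ⟩
    ∑< n f ℤ.+ f n                 ∎
    where open ≡-Reasoning

  ∑<-const : ∀ n x → ∑< n (λ _ → x) ≡ + n ℤ.* x
  ∑<-const zero    x = refl
  ∑<-const (suc n) x = trans (cong (λ y → x ℤ.+ y) (∑<-const n x)) (sym (ℤ.suc-* (+ n) x))

  ∑<-rotate : ∀ n f → f n ≡ f 0 → ∑< n (f ∘ suc) ≡ ∑< n f
  ∑<-rotate n f fn≡f0 = +-cancelˡ (f 0) _ _ (begin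
    f 0 ℤ.+ ∑< n (f ∘ suc)  ≡⟨ ∑<-suc n f ⟩
    ∑< n f ℤ.+ f n          ≡⟨ cong (λ x → ∑< n f ℤ.+ x) fn≡f0 ⟩
    ∑< n f ℤ.+ f 0          ≡⟨ ℤ.+-comm (∑< n f) (f 0) ⟩
    f 0 ℤ.+ ∑< n f          ∎)
    where open ≡-Reasoning

  -- The congruence `t * j ≡ 1` modulo `M`, with multiples of `M` allowed on both sides so that it
  -- can be stated in ℕ without subtraction.
  Invertible : ℕ → ℕ → Set
  Invertible M t = ∃[ j ] ∃[ y ] ∃[ z ] t * j + y * M ≡ 1 + z * M

  Invertible-* : ∀ {M t u} → Invertible M t → Invertible M u → Invertible M (t * u)
  Invertible-* {M} {t} {u} (j , y , z , eq) (j′ , y′ , z′ , eq′) =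
    j * j′ , y * (u * j′) + y′ * (t * j) + y * y′ * M , z + z′ + z * z′ * M ,
    trans (expand M t u j j′ y y′) (trans (cong₂ _*_ eq eq′) (collect M z z′))
    where
    expand : ∀ M t u j j′ y y′ → t * u * (j * j′) + (y * (u * j′) + y′ * (t * j) + y * y′ * M) * M
      ≡ (t * j + y * M) * (u * j′ + y′ * M)
    expand = ℕ-Solver.solve-∀
    collect : ∀ M z z′ → (1 + z * M) * (1 + z′ * M) ≡ 1 + (z + z′ + z * z′ * M) * M
    collect = ℕ-Solver.solve-∀

  module _ {M} .{{M≢0 : NonZero M}} {g : ℕ → ℤ} (periodic : ∀ x k → g (x + k * M) ≡ g x) where

    private
      T : ℕ → ℕ → ℤ
      T t x = ∑< M λ i → g (x + i * t)

      -- Moving the start by `t` rotates the sum: the argument that enters exceeds the one that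
      -- leaves by `M * t`, a multiple of the period.
      T-step : ∀ t x → T t (x + t) ≡ T t x
      T-step t x = trans
        (∑<-cong M λ i _ → cong g (ℕ.+-assoc x t (i * t)))
        (∑<-rotate M (λ i → g (x + i * t))
          (trans (cong (λ y → g (x + y)) (ℕ.*-comm M t))
            (trans (periodic x t) (cong g (sym (ℕ.+-identityʳ x))))))

      T-steps : ∀ t x j → T t (x + j * t) ≡ T t x
      T-steps t x zero    = cong (T t) (ℕ.+-identityʳ x)
      T-steps t x (suc j) = trans (cong (T t) (sym (ℕ.+-assoc x t (j * t))))
        (trans (T-steps t (x + t) j) (T-step t x))

      T-periodic : ∀ t x k → T t (x + k * M) ≡ T t x
      T-periodic t x k = ∑<-cong M λ i _ →
        trans (cong g (swap x (k * M) (i * t))) (periodic (x + i * t) k)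
        where
        swap : ∀ x y z → x + y + z ≡ x + z + y
        swap = ℕ-Solver.solve-∀

      -- Up to multiples of the period, a unit step is `j` steps of length `t`.
      T-suc : ∀ {t} → Invertible M t → ∀ x → T t (suc x) ≡ T t x
      T-suc {t} (j , y , z , eq) x = begin
        T t (suc x)               ≡⟨ T-periodic t (suc x) z ⟨
        T t (suc x + z * M)       ≡⟨ cong (T t) (ℕ.+-suc x (z * M)) ⟨
        T t (x + (1 + z * M))     ≡⟨ cong (λ w → T t (x + w)) eq ⟨
        T t (x + (t * j + y * M)) ≡⟨ cong (λ w → T t (x + (w + y * M))) (ℕ.*-comm t j) ⟩
        T t (x + (j * t + y * M)) ≡⟨ cong (T t) (ℕ.+-assoc x (j * t) (y * M)) ⟨
        T t (x + j * t + y * M)   ≡⟨ T-periodic t (x + j * t) y ⟩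
        T t (x + j * t)           ≡⟨ T-steps t x j ⟩
        T t x                     ∎
        where open ≡-Reasoning

      T-const : ∀ {t} → Invertible M t → ∀ x → T t x ≡ T t 0
      T-const inv zero    = refl
      T-const inv (suc x) = trans (T-suc inv x) (T-const inv x)

      T₁-const : ∀ x → T 1 x ≡ ∑< M g
      T₁-const x = trans (T-const (1 , 0 , 0 , refl) x) (∑<-cong M λ i _ → cong g (ℕ.*-identityʳ i))

    -- T t is invariant under x ↦ x + M and x ↦ x + t, hence constant; its mean
    -- over a period is ∑< M g by exchanging the two summations.
    ∑<-progression : ∑< M g ≡ 0ℤ → ∀ {t} → Invertible M t → ∀ x → ∑< M (λ i → g (x + i * t)) ≡ 0ℤ
    ∑<-progression ∑g≡0 {t} inv x = ℤ.*-cancelˡ-≡ (+ M) _ _ (begin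
      + M ℤ.* T t x
        ≡⟨ ∑<-const M (T t x) ⟨
      ∑< M (λ _ → T t x)
        ≡⟨ ∑<-cong M (λ y _ → trans (T-const inv x) (sym (T-const inv y))) ⟩
      ∑< M (λ y → ∑< M λ i → g (y + i * t))
        ≡⟨ ∑-comm {M} {M} (λ y i → g (toℕ y + toℕ i * t)) ⟩
      ∑< M (λ i → ∑< M λ y → g (y + i * t))
        ≡⟨ ∑<-zero M (λ i _ → trans (∑<-cong M (λ y _ → cong g (comm y (i * t)))) (trans (T₁-const (i * t)) ∑g≡0)) ⟩
      0ℤ
        ≡⟨ ℤ.*-zeroʳ (+ M) ⟨
      + M ℤ.* 0ℤ ∎)
      where
      open ≡-Reasoning
      comm : ∀ x y → x + y ≡ y + x * 1
      comm = ℕ-Solver.solve-∀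

    ∑<-progression-multiple : ∑< M g ≡ 0ℤ → ∀ {t} → Invertible M t →
      ∀ k x → ∑< (k * M) (λ i → g (x + i * t)) ≡ 0ℤ
    ∑<-progression-multiple ∑g≡0 {t} inv zero    x = refl
    ∑<-progression-multiple ∑g≡0 {t} inv (suc k) x = begin
      ∑< (M + k * M) (λ i → g (x + i * t))
        ≡⟨ ∑<-++ M (k * M) (λ i → g (x + i * t)) ⟩
      ∑< M (λ i → g (x + i * t)) ℤ.+ ∑< (k * M) (λ i → g (x + (M + i) * t))
        ≡⟨ cong₂ ℤ._+_ (∑<-progression ∑g≡0 inv x) (∑<-cong (k * M) λ i _ → cong g (assoc x M t i)) ⟩
      0ℤ ℤ.+ ∑< (k * M) (λ i → g ((x + M * t) + i * t))
        ≡⟨ cong (λ y → 0ℤ ℤ.+ y) (∑<-progression-multiple ∑g≡0 inv k (x + M * t)) ⟩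
      0ℤ ∎
      where
      open ≡-Reasoning
      assoc : ∀ x M t i → x + (M + i) * t ≡ x + M * t + i * t
      assoc = ℕ-Solver.solve-∀

  -- The centred residue

  -- Twice the deviation of `x % M` from the mean residue `(M - 1) / 2`; the doubling keeps it
  -- integral.
  φ : ∀ M .{{_ : NonZero M}} → ℕ → ℤ
  φ M x = + M ℤ.- 1ℤ ℤ.- + 2 ℤ.* + (x % M)

  φ-periodic : ∀ M .{{_ : NonZero M}} x k → φ M (x + k * M) ≡ φ M x
  φ-periodic M x k = cong (λ r → + M ℤ.- 1ℤ ℤ.- + 2 ℤ.* + r) ([m+kn]%n≡m%n x k M)

  ∑<-φ : ∀ M .{{_ : NonZero M}} → ∑< M (φ M) ≡ 0ℤ
  ∑<-φ M = begin
    ∑< M (φ M)                                   ≡⟨ ∑<-cong M (λ i i<M → cong (λ r → + M ℤ.- 1ℤ ℤ.- + 2 ℤ.* + r) (m<n⇒m%n≡m i<M)) ⟩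
    ∑< M (λ i → + M ℤ.- 1ℤ ℤ.- + 2 ℤ.* + i)      ≡⟨ linear M (+ M) ⟩
    + M ℤ.* (+ M ℤ.- + M)                        ≡⟨ cong (λ x → + M ℤ.* x) (ℤ.+-inverseʳ (+ M)) ⟩
    + M ℤ.* 0ℤ                                   ≡⟨ ℤ.*-zeroʳ (+ M) ⟩
    0ℤ                                           ∎
    where
    open ≡-Reasoning
    -- The induction needs `N` independent of the number of terms; at `N = n` the second factor
    -- vanishes.
    linear : ∀ n N → ∑< n (λ i → N ℤ.- 1ℤ ℤ.- + 2 ℤ.* + i) ≡ + n ℤ.* (N ℤ.- + n)
    linear zero    N = refl
    linear (suc n) N = begin
      ∑< (suc n) (λ i → N ℤ.- 1ℤ ℤ.- + 2 ℤ.* + i)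
        ≡⟨ ∑<-suc n (λ i → N ℤ.- 1ℤ ℤ.- + 2 ℤ.* + i) ⟩
      ∑< n (λ i → N ℤ.- 1ℤ ℤ.- + 2 ℤ.* + i) ℤ.+ (N ℤ.- 1ℤ ℤ.- + 2 ℤ.* + n)
        ≡⟨ cong (λ x → x ℤ.+ (N ℤ.- 1ℤ ℤ.- + 2 ℤ.* + n)) (linear n N) ⟩
      + n ℤ.* (N ℤ.- + n) ℤ.+ (N ℤ.- 1ℤ ℤ.- + 2 ℤ.* + n)
        ≡⟨ lemma (+ n) N ⟩
      + suc n ℤ.* (N ℤ.- + suc n) ∎
      where
      lemma : ∀ n N → n ℤ.* (N ℤ.- n) ℤ.+ (N ℤ.- 1ℤ ℤ.- + 2 ℤ.* n) ≡ (1ℤ ℤ.+ n) ℤ.* (N ℤ.- (1ℤ ℤ.+ n))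
      lemma = ℤ-Solver.solve-∀

  -- For `M = suc m` and residue `r` the value is the difference of the naturals `m ∸ r` and `r`,
  -- neither of which exceeds `m`.
  ∣φ∣≤ : ∀ M .{{_ : NonZero M}} x → ℤ.∣ φ M x ∣ ≤ ℕ.pred M
  ∣φ∣≤ (suc m) x = begin
    ℤ.∣ φ (suc m) x ∣          ≡⟨ cong ℤ.∣_∣ split ⟩
    ℤ.∣ (m ∸ r) ℤ.⊖ r ∣        ≤⟨ ℤ.∣m⊝n∣≤m⊔n (m ∸ r) r ⟩
    (m ∸ r) ℕ.⊔ r              ≤⟨ ℕ.⊔-lub (ℕ.m∸n≤m m r) r≤m ⟩
    m                          ∎
    where
    open ℕ.≤-Reasoning
    r : ℕ
    r = x % suc m
    r≤m : r ≤ m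
    r≤m = ℕ.s≤s⁻¹ (m%n<n x (suc m))
    lemma : ∀ d r → (1ℤ ℤ.+ (d ℤ.+ r)) ℤ.- 1ℤ ℤ.- + 2 ℤ.* r ≡ d ℤ.- r
    lemma = ℤ-Solver.solve-∀
    split : φ (suc m) x ≡ (m ∸ r) ℤ.⊖ r
    split = trans
      (cong (λ k → + suc k ℤ.- 1ℤ ℤ.- + 2 ℤ.* + r) (sym (ℕ.m∸n+n≡m r≤m)))
      (trans (lemma (+ (m ∸ r)) (+ r)) (ℤ.m-n≡m⊖n (m ∸ r) r))

  ∣∑<∣≤ : ∀ n f {B} → (∀ i → ℤ.∣ f i ∣ ≤ B) → ℤ.∣ ∑< n f ∣ ≤ n * B
  ∣∑<∣≤ zero    f f≤B = z≤n
  ∣∑<∣≤ (suc n) f f≤B = ℕ.≤-trans (ℤ.∣i+j∣≤∣i∣+∣j∣ (f 0) _) (ℕ.+-mono-≤ (f≤B 0) (∣∑<∣≤ n (f ∘ suc) (f≤B ∘ suc)))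

  -- Bézout coefficients and the error term for two parts

  -- A Bézout identity has one negative coefficient, say -y on b. Adding y copies of ab turns it
  -- into y(a - 1), so that both coefficients are natural numbers and one equation exhibits both
  -- inverses.
  coprime-Bézout⁺ : ∀ {a b} .{{_ : NonZero a}} .{{_ : NonZero b}} → Coprime a b →
    ∃[ a′ ] ∃[ b′ ] ∃[ w ] a * a′ + b * b′ ≡ 1 + w * (a * b)
  coprime-Bézout⁺ {suc a} {suc b} a⊥b with coprime-Bézout a⊥b
  ... | Bézout.+- x y eq = x , y * a , y ,
    trans (cong (_+ suc b * (y * a)) (trans (ℕ.*-comm (suc a) x) (sym eq))) (collect a b y)
    where
    collect : ∀ a b y → 1 + y * suc b + suc b * (y * a) ≡ 1 + y * (suc a * suc b)
    collect = ℕ-Solver.solve-∀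
  ... | Bézout.-+ x y eq = x * b , y , x ,
    trans (cong (λ z → suc a * (x * b) + z) (trans (ℕ.*-comm (suc b) y) (sym eq))) (collect a b x)
    where
    collect : ∀ a b x → suc a * (x * b) + (1 + x * suc a) ≡ 1 + x * (suc a * suc b)
    collect = ℕ-Solver.solve-∀

  coprime⇒Invertible : ∀ {a c} .{{_ : NonZero a}} .{{_ : NonZero c}} → Coprime a c → Invertible a c
  coprime⇒Invertible {a} {c} a⊥c with coprime-Bézout⁺ a⊥c
  ... | a′ , c′ , w , eq = c′ , a′ , w * c , trans (swap a c a′ c′) (trans eq (assoc a c w))
    where
    swap : ∀ a c a′ c′ → c * c′ + a′ * a ≡ a * a′ + c * c′
    swap = ℕ-Solver.solve-∀
    assoc : ∀ a c w → 1 + w * (a * c) ≡ 1 + w * c * a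
    assoc = ℕ-Solver.solve-∀

  module TwoParts {a b} .{{a≢0 : NonZero a}} .{{b≢0 : NonZero b}} (a⊥b : Coprime a b)
    (a′ b′ w : ℕ) (bézout : a * a′ + b * b′ ≡ 1 + w * (a * b)) where

    E : ℕ → ℤ
    E n = + b ℤ.* φ a (b′ * n) ℤ.+ + a ℤ.* φ b (a′ * n)

    b′-invertible : Invertible a b′
    b′-invertible = b , a′ , w * b , trans (swap a b a′ b′) (trans bézout (assoc a b w))
      where
      swap : ∀ a b a′ b′ → b′ * b + a′ * a ≡ a * a′ + b * b′
      swap = ℕ-Solver.solve-∀
      assoc : ∀ a b w → 1 + w * (a * b) ≡ 1 + w * b * a
      assoc = ℕ-Solver.solve-∀

    a′-invertible : Invertible b a′
    a′-invertible = a , b′ , w * a , trans (swap a b a′ b′) (trans bézout (assoc a b w))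
      where
      swap : ∀ a b a′ b′ → a′ * a + b′ * b ≡ a * a′ + b * b′
      swap = ℕ-Solver.solve-∀
      assoc : ∀ a b w → 1 + w * (a * b) ≡ 1 + w * a * b
      assoc = ℕ-Solver.solve-∀

    ∣E∣≤ : ∀ n → ℤ.∣ E n ∣ ≤ b * ℕ.pred a + a * ℕ.pred b
    ∣E∣≤ n = begin
      ℤ.∣ E n ∣                                             ≤⟨ ℤ.∣i+j∣≤∣i∣+∣j∣ (+ b ℤ.* φ a (b′ * n)) (+ a ℤ.* φ b (a′ * n)) ⟩
      ℤ.∣ + b ℤ.* φ a (b′ * n) ∣ + ℤ.∣ + a ℤ.* φ b (a′ * n) ∣ ≡⟨ cong₂ _+_ (ℤ.abs-* (+ b) (φ a (b′ * n))) (ℤ.abs-* (+ a) (φ b (a′ * n))) ⟩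
      b * ℤ.∣ φ a (b′ * n) ∣ + a * ℤ.∣ φ b (a′ * n) ∣       ≤⟨ ℕ.+-mono-≤ (ℕ.*-monoʳ-≤ b (∣φ∣≤ a (b′ * n))) (ℕ.*-monoʳ-≤ a (∣φ∣≤ b (a′ * n))) ⟩
      b * ℕ.pred a + a * ℕ.pred b                           ∎
      where open ℕ.≤-Reasoning

    -- The arguments of the two residues advance by `b′ * c` and `a′ * c`, invertible modulo `a` and
    -- `b` respectively, and `k * (a * b)` terms make a whole number of periods of each.
    ∑<-E : ∀ {c} → Invertible a c → Invertible b c →
      ∀ k x → ∑< (k * (a * b)) (λ i → E (x + i * c)) ≡ 0ℤ
    ∑<-E {c} a⊥c b⊥c k x = begin
      ∑< m (λ i → E (x + i * c))
        ≡⟨ ∑<-cong m (λ i _ → cong₂ (λ y z → + b ℤ.* φ a y ℤ.+ + a ℤ.* φ b z) (distrib b′ x i c) (distrib a′ x i c)) ⟩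
      ∑< m (λ i → + b ℤ.* u i ℤ.+ + a ℤ.* v i)
        ≡⟨ ∑-distrib-+ {m} (λ i → + b ℤ.* u (toℕ i)) (λ i → + a ℤ.* v (toℕ i)) ⟩
      ∑< m (λ i → + b ℤ.* u i) ℤ.+ ∑< m (λ i → + a ℤ.* v i)
        ≡⟨ cong₂ ℤ._+_ (*-distribˡ-sum {m} (+ b) (u ∘ toℕ)) (*-distribˡ-sum {m} (+ a) (v ∘ toℕ)) ⟨
      + b ℤ.* ∑< m u ℤ.+ + a ℤ.* ∑< m v
        ≡⟨ cong₂ (λ y z → + b ℤ.* y ℤ.+ + a ℤ.* z) ∑u≡0 ∑v≡0 ⟩
      + b ℤ.* 0ℤ ℤ.+ + a ℤ.* 0ℤ
        ≡⟨ cong₂ ℤ._+_ (ℤ.*-zeroʳ (+ b)) (ℤ.*-zeroʳ (+ a)) ⟩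
      0ℤ ∎
      where
      open ≡-Reasoning
      m : ℕ
      m = k * (a * b)
      u v : ℕ → ℤ
      u i = φ a (b′ * x + i * (b′ * c))
      v i = φ b (a′ * x + i * (a′ * c))
      distrib : ∀ e x i c → e * (x + i * c) ≡ e * x + i * (e * c)
      distrib = ℕ-Solver.solve-∀
      swap : ∀ k a b → k * (a * b) ≡ k * b * a
      swap = ℕ-Solver.solve-∀
      ∑u≡0 : ∑< m u ≡ 0ℤ
      ∑u≡0 = trans (cong (λ l → ∑< l u) (swap k a b))
        (∑<-progression-multiple (φ-periodic a) (∑<-φ a) (Invertible-* {a} {b′} b′-invertible a⊥c) (k * b) (b′ * x))
      ∑v≡0 : ∑< m v ≡ 0ℤ
      ∑v≡0 = trans (cong (λ l → ∑< l v) (sym (ℕ.*-assoc k a b)))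
        (∑<-progression-multiple (φ-periodic b) (∑<-φ b) (Invertible-* {b} {a′} a′-invertible b⊥c) (k * a) (a′ * x))

    module _ (p₂ : PowerSeries) (δδp₂ : δ a (δ b p₂) ≗ 𝟙) where

      -- Multiplying `bézout` by `n` and dividing `b′ * n` by `a` and `a′ * n` by `b` with remainder
      -- brings `n` into the form from which `p₂-count` reads off the count.
      p₂-formula : ∀ n → + 2 ℤ.* + a ℤ.* + b ℤ.* p₂ n ≡ + 2 ℤ.* + n ℤ.+ + a ℤ.+ + b ℤ.+ E n
      p₂-formula n = trans (cong (λ p → + 2 ℤ.* + a ℤ.* + b ℤ.* p) p₂≡K)
        (solution (+ a) (+ b) (+ u) (+ v) (+ K) (+ n) eqℤ)
        where
        u v q₁ q₂ K : ℕ
        u = b′ * n % a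
        v = a′ * n % b
        q₁ = b′ * n / a
        q₂ = a′ * n / b
        -- The extra one is the `a * b` added to `n` in `p₂-count`. It also makes the subtraction
        -- exact: the remainders contribute less than `2 * (a * b)` to `total`, whence `wn≤`.
        K = suc (q₁ + q₂) ∸ w * n

        total : n + a * b * (w * n) ≡ b * u + a * v + a * b * (q₁ + q₂)
        total = begin
          n + a * b * (w * n)                     ≡⟨ e₁ a b w n ⟩
          (1 + w * (a * b)) * n                   ≡⟨ cong (_* n) bézout ⟨
          (a * a′ + b * b′) * n                   ≡⟨ e₂ a b a′ b′ n ⟩
          b * (b′ * n) + a * (a′ * n)             ≡⟨ cong₂ (λ x y → b * x + a * y) (m≡m%n+[m/n]*n (b′ * n) a) (m≡m%n+[m/n]*n (a′ * n) b) ⟩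
          b * (u + q₁ * a) + a * (v + q₂ * b)     ≡⟨ e₃ a b u v q₁ q₂ ⟩
          b * u + a * v + a * b * (q₁ + q₂)       ∎
          where
          open ≡-Reasoning
          e₁ : ∀ a b w n → n + a * b * (w * n) ≡ (1 + w * (a * b)) * n
          e₁ = ℕ-Solver.solve-∀
          e₂ : ∀ a b a′ b′ n → (a * a′ + b * b′) * n ≡ b * (b′ * n) + a * (a′ * n)
          e₂ = ℕ-Solver.solve-∀
          e₃ : ∀ a b u v q₁ q₂ → b * (u + q₁ * a) + a * (v + q₂ * b) ≡ b * u + a * v + a * b * (q₁ + q₂)
          e₃ = ℕ-Solver.solve-∀

        u<a : u < a
        u<a = m%n<n (b′ * n) a
        v<b : v < b
        v<b = m%n<n (a′ * n) b

        wn≤ : w * n ≤ suc (q₁ + q₂)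
        wn≤ = ℕ.s≤s⁻¹ (ℕ.*-cancelˡ-< (a * b) (w * n) (2 + (q₁ + q₂)) (begin-strict
          a * b * (w * n)                          ≤⟨ ℕ.m≤n+m _ n ⟩
          n + a * b * (w * n)                      ≡⟨ total ⟩
          b * u + a * v + a * b * (q₁ + q₂)        <⟨ ℕ.+-monoˡ-< _ (ℕ.+-mono-< (ℕ.*-monoʳ-< b u<a) (ℕ.*-monoʳ-< a v<b)) ⟩
          b * a + a * b + a * b * (q₁ + q₂)        ≡⟨ e a b (q₁ + q₂) ⟩
          a * b * (2 + (q₁ + q₂))                  ∎))
          where
          open ℕ.≤-Reasoning
          e : ∀ a b q → b * a + a * b + a * b * q ≡ a * b * (2 + q)
          e = ℕ-Solver.solve-∀

        eq : n + a * b ≡ b * u + a * v + a * b * K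
        eq = ℕ.+-cancelʳ-≡ (a * b * (w * n)) _ _ (begin
          n + a * b + a * b * (w * n)                          ≡⟨ swap n (a * b) _ ⟩
          n + a * b * (w * n) + a * b                          ≡⟨ cong (_+ a * b) total ⟩
          b * u + a * v + a * b * (q₁ + q₂) + a * b            ≡⟨ e₁ (b * u + a * v) (a * b) (q₁ + q₂) ⟩
          b * u + a * v + a * b * suc (q₁ + q₂)                ≡⟨ cong (λ x → b * u + a * v + a * b * x) (ℕ.m∸n+n≡m wn≤) ⟨
          b * u + a * v + a * b * (K + w * n)                  ≡⟨ e₂ (b * u + a * v) (a * b) K (w * n) ⟩
          b * u + a * v + a * b * K + a * b * (w * n)          ∎)
          where
          open ≡-Reasoning
          swap : ∀ x y z → x + y + z ≡ x + z + y
          swap = ℕ-Solver.solve-∀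
          e₁ : ∀ x y q → x + y * q + y ≡ x + y * suc q
          e₁ = ℕ-Solver.solve-∀
          e₂ : ∀ x y q z → x + y * (q + z) ≡ x + y * q + y * z
          e₂ = ℕ-Solver.solve-∀

        p₂≡K : p₂ n ≡ + K
        p₂≡K = p₂-count {p₁ = δ b p₂} δδp₂ a⊥b p₂ (λ _ → refl) n K u<a v<b eq

        eqℤ : + n ℤ.+ + a ℤ.* + b ≡ + b ℤ.* + u ℤ.+ + a ℤ.* + v ℤ.+ + a ℤ.* + b ℤ.* + K
        eqℤ = begin
          + n ℤ.+ + a ℤ.* + b                  ≡⟨ cong (λ x → + n ℤ.+ x) (ℤ.pos-* a b) ⟨
          + (n + a * b)                        ≡⟨ cong +_ eq ⟩
          + (b * u) ℤ.+ + (a * v) ℤ.+ + (a * b * K)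
            ≡⟨ cong₂ ℤ._+_ (cong₂ ℤ._+_ (ℤ.pos-* b u) (ℤ.pos-* a v)) (trans (ℤ.pos-* (a * b) K) (cong (λ x → x ℤ.* + K) (ℤ.pos-* a b))) ⟩
          + b ℤ.* + u ℤ.+ + a ℤ.* + v ℤ.+ + a ℤ.* + b ℤ.* + K ∎
          where open ≡-Reasoning

        solution : ∀ a b u v K n → n ℤ.+ a ℤ.* b ≡ b ℤ.* u ℤ.+ a ℤ.* v ℤ.+ a ℤ.* b ℤ.* K →
          + 2 ℤ.* a ℤ.* b ℤ.* K ≡ + 2 ℤ.* n ℤ.+ a ℤ.+ b ℤ.+
            (b ℤ.* (a ℤ.- 1ℤ ℤ.- + 2 ℤ.* u) ℤ.+ a ℤ.* (b ℤ.- 1ℤ ℤ.- + 2 ℤ.* v))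
        solution a b u v K n eq = begin
          + 2 ℤ.* a ℤ.* b ℤ.* K
            ≡⟨ e₁ a b u v K ⟩
          + 2 ℤ.* (b ℤ.* u ℤ.+ a ℤ.* v ℤ.+ a ℤ.* b ℤ.* K) ℤ.- + 2 ℤ.* (b ℤ.* u ℤ.+ a ℤ.* v)
            ≡⟨ cong (λ x → + 2 ℤ.* x ℤ.- + 2 ℤ.* (b ℤ.* u ℤ.+ a ℤ.* v)) eq ⟨
          + 2 ℤ.* (n ℤ.+ a ℤ.* b) ℤ.- + 2 ℤ.* (b ℤ.* u ℤ.+ a ℤ.* v)
            ≡⟨ e₂ a b u v n ⟩
          + 2 ℤ.* n ℤ.+ a ℤ.+ b ℤ.+ (b ℤ.* (a ℤ.- 1ℤ ℤ.- + 2 ℤ.* u) ℤ.+ a ℤ.* (b ℤ.- 1ℤ ℤ.- + 2 ℤ.* v)) ∎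
          where
          open ≡-Reasoning
          e₁ : ∀ a b u v K → + 2 ℤ.* a ℤ.* b ℤ.* K ≡
            + 2 ℤ.* (b ℤ.* u ℤ.+ a ℤ.* v ℤ.+ a ℤ.* b ℤ.* K) ℤ.- + 2 ℤ.* (b ℤ.* u ℤ.+ a ℤ.* v)
          e₁ = ℤ-Solver.solve-∀
          e₂ : ∀ a b u v n → + 2 ℤ.* (n ℤ.+ a ℤ.* b) ℤ.- + 2 ℤ.* (b ℤ.* u ℤ.+ a ℤ.* v) ≡
            + 2 ℤ.* n ℤ.+ a ℤ.+ b ℤ.+ (b ℤ.* (a ℤ.- 1ℤ ℤ.- + 2 ℤ.* u) ℤ.+ a ℤ.* (b ℤ.- 1ℤ ℤ.- + 2 ℤ.* v))
          e₂ = ℤ-Solver.solve-∀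

  -- From two parts to three

  module _ {a b c} .{{a≢0 : NonZero a}} .{{b≢0 : NonZero b}} .{{c≢0 : NonZero c}}
    (a⊥b : Coprime a b) (a⊥c : Coprime a c) (b⊥c : Coprime b c)
    (p₃ : PowerSeries) (δδδp₃ : δ a (δ b (δ c p₃)) ≗ 𝟙) where

    -- The residue `m` of `n` modulo `c` stays in the formula together with `m < c`, because the
    -- lower estimate needs the sign of `c - m`.
    p₃-expansion : ∀ n → ∃[ m ] ∃[ X ] m < c × ℤ.∣ X ∣ ≤ ℕ.pred (a * b) * (b * ℕ.pred a + a * ℕ.pred b) ×
      + 2 ℤ.* + a ℤ.* + b ℤ.* + c ℤ.* p₃ n ≡
        + n ℤ.* (+ n ℤ.+ + a ℤ.+ + b ℤ.+ + c) ℤ.+ (+ c ℤ.- + m) ℤ.* (+ m ℤ.+ + a ℤ.+ + b) ℤ.+ + c ℤ.* X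
    p₃-expansion n with coprime-Bézout⁺ a⊥b
    ... | a′ , b′ , w , bézout = m , ∑< t e , m%n<n n c , X≤ ,
      (begin
        + 2 ℤ.* + a ℤ.* + b ℤ.* + c ℤ.* p₃ n
          ≡⟨ cong (λ x → + 2 ℤ.* + a ℤ.* + b ℤ.* + c ℤ.* p₃ x) n≡ ⟩
        + 2 ℤ.* + a ℤ.* + b ℤ.* + c ℤ.* p₃ (n / c * c + m)
          ≡⟨ telescoped (n / c) ⟩
        main (n / c * c + m) ℤ.+ + c ℤ.* ∑< (suc (n / c)) e
          ≡⟨ cong₂ (λ x y → main x ℤ.+ + c ℤ.* y) (sym n≡) truncated ⟩
        main n ℤ.+ + c ℤ.* ∑< t e ∎)
      where
      open ≡-Reasoning
      open TwoParts a⊥b a′ b′ w bézout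

      instance
        ab≢0 : NonZero (a * b)
        ab≢0 = ℕ.m*n≢0 a b

      m t k : ℕ
      m = n % c
      -- The progression `m`, `m + c`, ..., `n` has `suc (n / c)` terms, both ends included. Its
      -- first `t` errors are kept; the other `k` blocks of `a * b` cancel.
      t = suc (n / c) % (a * b)
      k = suc (n / c) / (a * b)

      e : ℕ → ℤ
      e i = E (m + i * c)

      -- The quadratic is chosen so that passing from x to c + x adds c(2(c + x) + a + b). The
      -- second summand, constant along the progression, gives it the initial value c(2m + a + b) at
      -- m.
      main : ℕ → ℤ
      main n = + n ℤ.* (+ n ℤ.+ + a ℤ.+ + b ℤ.+ + c) ℤ.+ (+ c ℤ.- + m) ℤ.* (+ m ℤ.+ + a ℤ.+ + b)

      n≡ : n ≡ n / c * c + m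
      n≡ = trans (m≡m%n+[m/n]*n n c) (ℕ.+-comm m _)

      X≤ : ℤ.∣ ∑< t e ∣ ≤ ℕ.pred (a * b) * (b * ℕ.pred a + a * ℕ.pred b)
      X≤ = ℕ.≤-trans (∣∑<∣≤ t e (λ i → ∣E∣≤ (m + i * c)))
        (ℕ.*-monoˡ-≤ _ (ℕ.<⇒≤pred (m%n<n (suc (n / c)) (a * b))))

      truncated : ∑< (suc (n / c)) e ≡ ∑< t e
      truncated = begin
        ∑< (suc (n / c)) e                                ≡⟨ cong (λ N → ∑< N e) (m≡m%n+[m/n]*n (suc (n / c)) (a * b)) ⟩
        ∑< (t + k * (a * b)) e                            ≡⟨ ∑<-++ t (k * (a * b)) e ⟩
        ∑< t e ℤ.+ ∑< (k * (a * b)) (λ i → e (t + i))     ≡⟨ cong (λ x → ∑< t e ℤ.+ x) rest≡0 ⟩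
        ∑< t e ℤ.+ 0ℤ                                     ≡⟨ ℤ.+-identityʳ _ ⟩
        ∑< t e                                            ∎
        where
        assoc : ∀ m t i c → m + (t + i) * c ≡ m + t * c + i * c
        assoc = ℕ-Solver.solve-∀
        rest≡0 : ∑< (k * (a * b)) (λ i → e (t + i)) ≡ 0ℤ
        rest≡0 = trans
          (∑<-cong (k * (a * b)) (λ i _ → cong E (assoc m t i c)))
          (∑<-E (coprime⇒Invertible a⊥c) (coprime⇒Invertible b⊥c) k (m + t * c))

      p₂-value : ∀ x → + 2 ℤ.* + a ℤ.* + b ℤ.* + c ℤ.* δ c p₃ x ≡ + c ℤ.* (+ 2 ℤ.* + x ℤ.+ + a ℤ.+ + b ℤ.+ E x)
      p₂-value x = trans (swap (+ a) (+ b) (+ c) (δ c p₃ x)) (cong (λ y → + c ℤ.* y) (p₂-formula (δ c p₃) δδδp₃ x))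
        where
        swap : ∀ a b c p → + 2 ℤ.* a ℤ.* b ℤ.* c ℤ.* p ≡ c ℤ.* (+ 2 ℤ.* a ℤ.* b ℤ.* p)
        swap = ℤ-Solver.solve-∀

      telescoped : ∀ j → + 2 ℤ.* + a ℤ.* + b ℤ.* + c ℤ.* p₃ (j * c + m) ≡
        main (j * c + m) ℤ.+ + c ℤ.* ∑< (suc j) e
      telescoped zero = begin
        + 2 ℤ.* + a ℤ.* + b ℤ.* + c ℤ.* p₃ m
          ≡⟨ cong (λ x → + 2 ℤ.* + a ℤ.* + b ℤ.* + c ℤ.* x) (δ-< p₃ (m%n<n n c)) ⟩
        + 2 ℤ.* + a ℤ.* + b ℤ.* + c ℤ.* δ c p₃ m
          ≡⟨ p₂-value m ⟩
        + c ℤ.* (+ 2 ℤ.* + m ℤ.+ + a ℤ.+ + b ℤ.+ E m)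
          ≡⟨ start (+ a) (+ b) (+ c) (+ m) (E m) ⟩
        main m ℤ.+ + c ℤ.* (E m ℤ.+ 0ℤ)
          ≡⟨ cong (λ x → main m ℤ.+ + c ℤ.* (E x ℤ.+ 0ℤ)) (ℕ.+-identityʳ m) ⟨
        main m ℤ.+ + c ℤ.* ∑< 1 e ∎
        where
        start : ∀ a b c m E → c ℤ.* (+ 2 ℤ.* m ℤ.+ a ℤ.+ b ℤ.+ E) ≡
          m ℤ.* (m ℤ.+ a ℤ.+ b ℤ.+ c) ℤ.+ (c ℤ.- m) ℤ.* (m ℤ.+ a ℤ.+ b) ℤ.+ c ℤ.* (E ℤ.+ 0ℤ)
        start = ℤ-Solver.solve-∀
      telescoped (suc j) = begin
        D ℤ.* p₃ (c + j * c + m)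
          ≡⟨ cong (λ y → D ℤ.* p₃ y) (ℕ.+-assoc c (j * c) m) ⟩
        D ℤ.* p₃ (c + x)
          ≡⟨ cong (λ y → D ℤ.* y) (δ-+ c p₃ x) ⟩
        D ℤ.* (p₃ x ℤ.+ δ c p₃ (c + x))
          ≡⟨ ℤ.*-distribˡ-+ D (p₃ x) (δ c p₃ (c + x)) ⟩
        D ℤ.* p₃ x ℤ.+ D ℤ.* δ c p₃ (c + x)
          ≡⟨ cong₂ ℤ._+_ (telescoped j) (p₂-value (c + x)) ⟩
        main x ℤ.+ + c ℤ.* ∑< (suc j) e ℤ.+ + c ℤ.* (+ 2 ℤ.* + (c + x) ℤ.+ + a ℤ.+ + b ℤ.+ E (c + x))
          ≡⟨ step (+ a) (+ b) (+ c) (+ m) (+ x) (∑< (suc j) e) (E (c + x)) ⟩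
        main (c + x) ℤ.+ + c ℤ.* (∑< (suc j) e ℤ.+ E (c + x))
          ≡⟨ cong₂ (λ y z → main y ℤ.+ + c ℤ.* (∑< (suc j) e ℤ.+ E z)) (sym (ℕ.+-assoc c (j * c) m)) (index m c (j * c)) ⟩
        main (c + j * c + m) ℤ.+ + c ℤ.* (∑< (suc j) e ℤ.+ e (suc j))
          ≡⟨ cong (λ y → main (c + j * c + m) ℤ.+ + c ℤ.* y) (∑<-suc (suc j) e) ⟨
        main (c + j * c + m) ℤ.+ + c ℤ.* ∑< (suc (suc j)) e ∎
        where
        x : ℕ
        x = j * c + m
        D : ℤ
        D = + 2 ℤ.* + a ℤ.* + b ℤ.* + c
        index : ∀ m c y → c + (y + m) ≡ m + (c + y)
        index = ℕ-Solver.solve-∀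
        step : ∀ a b c m x S E →
          x ℤ.* (x ℤ.+ a ℤ.+ b ℤ.+ c) ℤ.+ (c ℤ.- m) ℤ.* (m ℤ.+ a ℤ.+ b) ℤ.+ c ℤ.* S
            ℤ.+ c ℤ.* (+ 2 ℤ.* (c ℤ.+ x) ℤ.+ a ℤ.+ b ℤ.+ E)
          ≡ (c ℤ.+ x) ℤ.* (c ℤ.+ x ℤ.+ a ℤ.+ b ℤ.+ c) ℤ.+ (c ℤ.- m) ℤ.* (m ℤ.+ a ℤ.+ b) ℤ.+ c ℤ.* (S ℤ.+ E)
        step = ℤ-Solver.solve-∀

-- The coprimality of the three parts

module _ {r s} (s≤r : s ℕ.≤ r) (r⊥s : Coprime r s) where

  s⊥r-s : Coprime s (r ℕ.∸ s)
  s⊥r-s (d∣s , d∣r-s) = r⊥s (∣m∸n∣n⇒∣m _ s≤r d∣r-s d∣s , d∣s)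

  s⊥r+s : Coprime s (r ℕ.+ s)
  s⊥r+s {d} (d∣s , d∣r+s) = r⊥s (∣m+n∣m⇒∣n (subst (d ∣_) (ℕ.+-comm r s) d∣r+s) d∣s , d∣s)

  -- A common divisor of r - s and r + s divides 2s, and it is odd because
  -- s is even and r is odd.
  r-s⊥r+s : 2 ∣ s → Coprime (r ℕ.∸ s) (r ℕ.+ s)
  r-s⊥r+s 2∣s {d} (d∣r-s , d∣r+s) = s⊥r-s (d∣s , d∣r-s)
    where
    d⊥2 : Coprime d 2
    d⊥2 (e∣d , e∣2) = s⊥r-s (∣-trans e∣2 2∣s , ∣-trans e∣d d∣r-s)
    twice : ∀ b s → b ℕ.+ s ℕ.+ s ≡ b ℕ.+ 2 ℕ.* s
    twice = ℕ-Solver.solve-∀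
    r+s≡ : r ℕ.+ s ≡ r ℕ.∸ s ℕ.+ 2 ℕ.* s
    r+s≡ = trans (cong (ℕ._+ s) (sym (ℕ.m∸n+n≡m s≤r))) (twice (r ℕ.∸ s) s)
    d∣s : d ∣ s
    d∣s = coprime-divisor d⊥2 (∣m+n∣m⇒∣n (subst (d ∣_) r+s≡ d∣r+s) d∣r-s)

-- The polynomial inequalities

module _ where
  open import Data.Integer.Base using (_+_; _*_; _-_; -_; _≤_)

  infixl 6 _⊕_
  infixl 7 _⊗_

  _⊕_ : ∀ {x y} → 0ℤ ≤ x → 0ℤ ≤ y → 0ℤ ≤ x + y
  _⊕_ = ℤ.+-mono-≤

  _⊗_ : ∀ {x y} → 0ℤ ≤ x → 0ℤ ≤ y → 0ℤ ≤ x * y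
  _⊗_ {+ x} {+ y} _ _ = subst (0ℤ ≤_) (ℤ.pos-* x y) (ℤ.+≤+ z≤n)

  0≤+ : ∀ {n} → 0ℤ ≤ + n
  0≤+ = ℤ.+≤+ z≤n

  i≤∣i∣ : ∀ i → i ≤ + ℤ.∣ i ∣
  i≤∣i∣ (+ n)      = ℤ.≤-refl
  i≤∣i∣ ℤ.-[1+ n ] = ℤ.-≤+

  ∣i∣≤n⇒0≤n-i : ∀ i {n} → ℤ.∣ i ∣ ℕ.≤ n → 0ℤ ≤ + n - i
  ∣i∣≤n⇒0≤n-i i ∣i∣≤n = ℤ.i≤j⇒0≤j-i (ℤ.≤-trans (i≤∣i∣ i) (ℤ.+≤+ ∣i∣≤n))

  ∣i∣≤n⇒0≤n+i : ∀ i {n} → ℤ.∣ i ∣ ℕ.≤ n → 0ℤ ≤ + n + i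
  ∣i∣≤n⇒0≤n+i i {n} ∣i∣≤n = subst (λ j → 0ℤ ≤ + n + j) (ℤ.neg-involutive i)
    (∣i∣≤n⇒0≤n-i (- i) (subst (ℕ._≤ n) (sym (ℤ.∣-i∣≡∣i∣ i)) ∣i∣≤n))

  -- The slack in the upper and in the lower estimate.
  Rᵘ Rᵈ : ℤ → ℤ → ℤ
  Rᵘ r s = r * r * (+ 4 * s - + 2) - r * (+ 4 * s - 1ℤ) - + 4 * s * s * s + s * s
  Rᵈ r s = + 2 * s * r * r * r + r * r * (+ 2 * s - 1ℤ)
    - r * (+ 2 * s * s * s + + 3 * s + 1ℤ) - + 2 * s * s * s + + 2 * s * s

  -- After s = 1 + e and r = 1 + 2s + d all coefficients are nonnegative.
  module _ (e d : ℕ) where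

    private
      s r : ℤ
      s = 1ℤ + + e
      r = 1ℤ + + 2 * s + + d

    0≤Rᵘ : 0ℤ ≤ Rᵘ r s
    -- The proof term has the Horner shape of the right side of `expand`, with `0≤+` for each
    -- numeral.
    0≤Rᵘ = subst (0ℤ ≤_) (sym (expand (+ e) (+ d)))
      (0≤+ ⊕ D ⊗ (0≤+ ⊕ D ⊗ 0≤+) ⊕ E ⊗ (0≤+ ⊕ D ⊗ (0≤+ ⊕ D ⊗ 0≤+) ⊕ E ⊗ (0≤+ ⊕ D ⊗ 0≤+ ⊕ E ⊗ 0≤+)))
      where
      D : 0ℤ ≤ + d
      D = 0≤+
      E : 0ℤ ≤ + e
      E = 0≤+
      expand : ∀ e d → let s = 1ℤ + e; r = 1ℤ + + 2 * s + d in
        r * r * (+ 4 * s - + 2) - r * (+ 4 * s - 1ℤ) - + 4 * s * s * s + s * s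
        ≡ + 6 + d * (+ 9 + d * + 2)
          + e * (+ 32 + d * (+ 28 + d * + 4) + e * (+ 37 + d * + 16 + e * + 12))
      expand = ℤ-Solver.solve-∀

    0≤Rᵈ : 0ℤ ≤ Rᵈ r s
    0≤Rᵈ = subst (0ℤ ≤_) (sym (expand (+ e) (+ d)))
      (0≤+ ⊕ D ⊗ (0≤+ ⊕ D ⊗ (0≤+ ⊕ D ⊗ 0≤+)) ⊕ E ⊗ (0≤+ ⊕ D ⊗ (0≤+ ⊕ D ⊗ (0≤+ ⊕ D ⊗ 0≤+))
        ⊕ E ⊗ (0≤+ ⊕ D ⊗ (0≤+ ⊕ D ⊗ 0≤+) ⊕ E ⊗ (0≤+ ⊕ D ⊗ 0≤+ ⊕ E ⊗ 0≤+))))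
      where
      D : 0ℤ ≤ + d
      D = 0≤+
      E : 0ℤ ≤ + e
      E = 0≤+
      expand : ∀ e d → let s = 1ℤ + e; r = 1ℤ + + 2 * s + d in
        + 2 * s * r * r * r + r * r * (+ 2 * s - 1ℤ)
          - r * (+ 2 * s * s * s + + 3 * s + 1ℤ) - + 2 * s * s * s + + 2 * s * s
        ≡ + 45 + d * (+ 54 + d * (+ 19 + d * + 2))
          + e * (+ 151 + d * (+ 133 + d * (+ 32 + d * + 2))
          + e * (+ 168 + d * (+ 98 + d * + 12)
          + e * (+ 76 + d * + 22 + e * + 12)))
      expand = ℤ-Solver.solve-∀

  -- The bound on |X| in p₃-expansion for the parts s, b and b + 2s.
  W : ℤ → ℤ → ℤ
  W b s = (s * b - 1ℤ) * (b * (s - 1ℤ) + s * (b - 1ℤ))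

  expansion : (b s n m X : ℤ) → ℤ
  expansion b s n m X =
    n * (n + s + b + (b + s + s)) + (b + s + s - m) * (m + s + b) + (b + s + s) * X

  -- With c = r + s the residue term (c - m)(m + r) is r² + rs + ms - m². The `s * s` split off from
  -- the rest dominates its varying part ms - m², because ms is at most the larger of s² and m².
  upper-identity : ∀ b s n m X →
    P₂-numerator (b + s) s n + Cᵘ₃-numerator (b + s) s ≡
    expansion b s n m X + (s * s + m * m - m * s + (b + s + s) * (W b s - X) + Rᵘ (b + s) s)
  upper-identity = identity
    where
    -- The ring solver does not accept _^_, so the powers are unfolded.
    identity : ∀ b s n m X → let
        r = b + s; r² = r * (r * 1ℤ); r³ = r * r²; c = b + s + s
        s² = s * (s * 1ℤ); s³ = s * s²; s⁴ = s * s³; s⁵ = s * s⁴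
      in
      n * (n * 1ℤ) + + 2 * n * r + n * s + + 2 * r + s - + 1 +
      (r³ * (+ 2 * s² - s)
        + r² * (+ 2 * s - + 2 * s³)
        + r * (- (+ 2 * s⁴) + s³ - + 2 * s - + 1)
        + + 2 * s⁵ - + 2 * s³ + + 2 * s² - s + + 1)
      ≡ n * (n + s + b + c) + (c - m) * (m + s + b) + c * X
        + (s * s + m * m - m * s
          + c * ((s * b - 1ℤ) * (b * (s - 1ℤ) + s * (b - 1ℤ)) - X)
          + (r * r * (+ 4 * s - + 2) - r * (+ 4 * s - 1ℤ) - + 4 * s * s * s + s * s))
    identity = ℤ-Solver.solve-∀

  -- Here the residue term is itself nonnegative for `m < c` and joins the slack unchanged.
  lower-identity : ∀ b s n m X →
    expansion b s n m X ≡
    P₂-numerator (b + s) s n + Cᵈ₃-numerator (b + s) s +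
      ((b + s + s - m) * (m + s + b) + (b + s + s) * (W b s + X) + Rᵈ (b + s) s)
  lower-identity = identity
    where
    identity : ∀ b s n m X → let
        r = b + s; r² = r * (r * 1ℤ); r³ = r * r²; c = b + s + s
        s² = s * (s * 1ℤ); s³ = s * s²; s⁴ = s * s³; s⁵ = s * s⁴
      in
      n * (n + s + b + c) + (c - m) * (m + s + b) + c * X
      ≡ n * (n * 1ℤ) + + 2 * n * r + n * s + + 2 * r + s - + 1 +
      (r³ * (- (+ 2 * s²) - s)
        + + 2 * r² * s³
        + r * (+ 2 * s⁴ + s³ + + 2 * s - + 1)
        - + 2 * s⁵ - + 2 * s² - s + + 1)
        + ((c - m) * (m + s + b)
          + c * ((s * b - 1ℤ) * (b * (s - 1ℤ) + s * (b - 1ℤ)) + X)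
          + (+ 2 * s * r * r * r + r * r * (+ 2 * s - 1ℤ)
            - r * (+ 2 * s * s * s + + 3 * s + 1ℤ) - + 2 * s * s * s + + 2 * s * s))
    identity = ℤ-Solver.solve-∀

  +pred : ∀ n .{{_ : NonZero n}} → + ℕ.pred n ≡ + n - 1ℤ
  +pred (suc n) = refl

  +W : ∀ b s .{{_ : NonZero b}} .{{_ : NonZero s}} →
    + (ℕ.pred (s ℕ.* b) ℕ.* (b ℕ.* ℕ.pred s ℕ.+ s ℕ.* ℕ.pred b)) ≡ W (+ b) (+ s)
  +W b s = begin
    + (ℕ.pred (s ℕ.* b) ℕ.* (b ℕ.* ℕ.pred s ℕ.+ s ℕ.* ℕ.pred b))
      ≡⟨ ℤ.pos-* (ℕ.pred (s ℕ.* b)) _ ⟩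
    + ℕ.pred (s ℕ.* b) * (+ (b ℕ.* ℕ.pred s) + + (s ℕ.* ℕ.pred b))
      ≡⟨ cong₂ _*_ (trans (+pred (s ℕ.* b) {{ℕ.m*n≢0 s b}}) (cong (_- 1ℤ) (ℤ.pos-* s b)))
           (cong₂ _+_ (+*pred b s) (+*pred s b)) ⟩
    W (+ b) (+ s) ∎
    where
    open ≡-Reasoning
    +*pred : ∀ m n .{{_ : NonZero n}} → + (m ℕ.* ℕ.pred n) ≡ + m * (+ n - 1ℤ)
    +*pred m n = trans (ℤ.pos-* m (ℕ.pred n)) (cong (λ x → + m * x) (+pred n))

  0≤s²+m²-ms : ∀ m s → 0ℤ ≤ + s * + s + + m * + m - + m * + s
  0≤s²+m²-ms m s = ℤ.i≤j⇒0≤j-i (begin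
    + m * + s                    ≡⟨ ℤ.pos-* m s ⟨
    + (m ℕ.* s)                  ≤⟨ ℤ.+≤+ ms≤ ⟩
    + (s ℕ.* s) + + (m ℕ.* m)    ≡⟨ cong₂ _+_ (ℤ.pos-* s s) (ℤ.pos-* m m) ⟩
    + s * + s + + m * + m        ∎)
    where
    open ℤ.≤-Reasoning
    ms≤ : m ℕ.* s ℕ.≤ s ℕ.* s ℕ.+ m ℕ.* m
    ms≤ with ℕ.≤-total m s
    ... | inj₁ m≤s = ℕ.≤-trans (ℕ.*-monoˡ-≤ s m≤s) (ℕ.m≤m+n _ _)
    ... | inj₂ s≤m = ℕ.≤-trans (ℕ.*-monoʳ-≤ m s≤m) (ℕ.m≤n+m _ _)

  module _ {b s} (s⊥b : Coprime s b) (s⊥c : Coprime s (b ℕ.+ s ℕ.+ s)) (b⊥c : Coprime b (b ℕ.+ s ℕ.+ s))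
    (1≤s : 1 ℕ.≤ s) (s<b : s ℕ.< b) (p₃ : PowerSeries) (δδδp₃ : δ s (δ b (δ (b ℕ.+ s ℕ.+ s) p₃)) ≗ 𝟙) where

    private
      instance
        s≢0 : NonZero s
        s≢0 = >-nonZero 1≤s
        b≢0 : NonZero b
        b≢0 = >-nonZero (ℕ.≤-trans (s≤s z≤n) s<b)
        c≢0 : NonZero (b ℕ.+ s ℕ.+ s)
        c≢0 = >-nonZero (ℕ.≤-trans 1≤s (ℕ.m≤n+m s (b ℕ.+ s)))

      -- The hypotheses `1 ≤ s` and `s < b` say exactly that the pair can be written in the
      -- coordinates `e` and `d` of the nonnegativity proofs.
      substituted : (Q : ℤ → ℤ → Set) →
        (∀ e d → Q (1ℤ + + 2 * (1ℤ + + e) + + d) (1ℤ + + e)) → Q (+ b + + s) (+ s)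
      substituted Q q = subst₂ Q
        (trans (collect (+ e) (+ d)) (cong₂ (λ x y → + x + + y) b≡ s≡)) (cong +_ s≡) (q e d)
        where
        e d : ℕ
        e = ℕ.pred s
        -- This is r - 2s - 1, since r = b + s.
        d = b ℕ.∸ suc s
        s≡ : suc e ≡ s
        s≡ = ℕ.suc-pred s
        b≡ : suc (suc e) ℕ.+ d ≡ b
        b≡ = trans (cong (λ x → suc x ℕ.+ d) s≡) (ℕ.m+[n∸m]≡n s<b)
        collect : ∀ e d → 1ℤ + + 2 * (1ℤ + e) + d ≡ + 2 + e + d + (1ℤ + e)
        collect = ℤ-Solver.solve-∀

    numerator-bounds : ∀ n →
      let numerator = + 2 * + s * + b * + (b ℕ.+ s ℕ.+ s) * p₃ n in
      P₂-numerator (+ (b ℕ.+ s)) (+ s) (+ n) + Cᵈ₃-numerator (+ (b ℕ.+ s)) (+ s) ≤ numerator ×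
      numerator ≤ P₂-numerator (+ (b ℕ.+ s)) (+ s) (+ n) + Cᵘ₃-numerator (+ (b ℕ.+ s)) (+ s)
    numerator-bounds n with p₃-expansion s⊥b s⊥c b⊥c p₃ δδδp₃ n
    ... | m , X , m<c , X≤ , eq = lower , upper
      where
      0≤c : 0ℤ ≤ + (b ℕ.+ s ℕ.+ s)
      0≤c = 0≤+
      lower = subst₂ _≤_ (ℤ.+-identityʳ _) (sym (trans eq (lower-identity (+ b) (+ s) (+ n) (+ m) X)))
        (ℤ.+-monoʳ-≤ (P₂-numerator (+ (b ℕ.+ s)) (+ s) (+ n) + Cᵈ₃-numerator (+ (b ℕ.+ s)) (+ s))
          (ℤ.i≤j⇒0≤j-i (ℤ.+≤+ (ℕ.<⇒≤ m<c)) ⊗ 0≤+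
            ⊕ 0≤c ⊗ subst (λ w → 0ℤ ≤ w + X) (+W b s) (∣i∣≤n⇒0≤n+i X X≤)
            ⊕ substituted (λ r s → 0ℤ ≤ Rᵈ r s) 0≤Rᵈ))
      upper = subst₂ _≤_ (trans (ℤ.+-identityʳ _) (sym eq)) (sym (upper-identity (+ b) (+ s) (+ n) (+ m) X))
        (ℤ.+-monoʳ-≤ (expansion (+ b) (+ s) (+ n) (+ m) X)
          (0≤s²+m²-ms m s
            ⊕ 0≤c ⊗ subst (λ w → 0ℤ ≤ w - X) (+W b s) (∣i∣≤n⇒0≤n-i X X≤)
            ⊕ substituted (λ r s → 0ℤ ≤ Rᵘ r s) 0≤Rᵘ))

-- Comparing fractions with integers

open import Data.Rational.Base using (_/_; _+_; _≤_; toℚᵘ)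

module _ (x y z : ℤ) where

  private
    -- Unnormalised fractions keep numerator and denominator as given, so sums over a common
    -- denominator can be compared by cross multiplication; `mkℚᵘ x d` has the denominator `suc d`.
    sum-/ : ∀ d → toℚᵘ (x / suc d + y / suc d) ℚᵘ.≃ mkℚᵘ (x ℤ.+ y) d
    sum-/ d = ℚᵘ.≃-trans (ℚ.toℚᵘ-homo-+ (x / suc d) (y / suc d))
      (ℚᵘ.≃-trans (ℚᵘ.+-cong (ℚ.toℚᵘ-fromℚᵘ (mkℚᵘ x d)) (ℚ.toℚᵘ-fromℚᵘ (mkℚᵘ y d)))
        (ℚᵘ.*≡* (trans (cross x y (+ suc d)) (cong (λ w → (x ℤ.+ y) ℤ.* w) (sym (ℤ.pos-* (suc d) (suc d)))))))
      where
      cross : ∀ x y d → (x ℤ.* d ℤ.+ y ℤ.* d) ℤ.* d ≡ (x ℤ.+ y) ℤ.* (d ℤ.* d)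
      cross = ℤ-Solver.solve-∀

  /+/≤ : ∀ d .{{_ : NonZero d}} → x ℤ.+ y ℤ.≤ z ℤ.* + d → x / d + y / d ≤ z / 1
  /+/≤ (suc d) x+y≤zd = ℚ.toℚᵘ-cancel-≤ (begin
    toℚᵘ (x / suc d + y / suc d)  ≃⟨ sum-/ d ⟩
    mkℚᵘ (x ℤ.+ y) d              ≤⟨ *≤* (subst (ℤ._≤ z ℤ.* + suc d) (sym (ℤ.*-identityʳ (x ℤ.+ y))) x+y≤zd) ⟩
    mkℚᵘ z 0                      ≃⟨ ℚ.toℚᵘ-fromℚᵘ (mkℚᵘ z 0) ⟨
    toℚᵘ (z / 1)                  ∎)
    where open ℚᵘ.≤-Reasoning

  ≤/+/ : ∀ d .{{_ : NonZero d}} → z ℤ.* + d ℤ.≤ x ℤ.+ y → z / 1 ≤ x / d + y / d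
  ≤/+/ (suc d) zd≤x+y = ℚ.toℚᵘ-cancel-≤ (begin
    toℚᵘ (z / 1)                  ≃⟨ ℚ.toℚᵘ-fromℚᵘ (mkℚᵘ z 0) ⟩
    mkℚᵘ z 0                      ≤⟨ *≤* (subst (z ℤ.* + suc d ℤ.≤_) (sym (ℤ.*-identityʳ (x ℤ.+ y))) zd≤x+y) ⟩
    mkℚᵘ (x ℤ.+ y) d              ≃⟨ sum-/ d ⟨
    toℚᵘ (x / suc d + y / suc d)  ∎)
    where open ℚᵘ.≤-Reasoning

-- From the generating function to the rational bounds

lemma4p1 : (r s : ℕ) → Coprime r s → 2 ∣ s → (1≤s : 1 ℕ.≤ s) → (2s<r : 2 ℕ.* s ℕ.< r) →
    (p₃ : PowerSeries) → p₃ ≗1/ denominator r s →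
    let instance
          Δ₁≢0 = Δ₁-nonZero 1≤s 2s<r
    in (n : ℕ) → (P₂ r s n + Cᵈ₃ r s ≤ p₃ n / 1) × (p₃ n / 1 ≤ P₂ r s n + Cᵘ₃ r s)
lemma4p1 r s r⊥s 2∣s 1≤s 2s<r p₃ p₃≗1/den n =
  -- The integer bounds are stated for `b + s` in place of `r`, which keeps truncated subtraction
  -- out of the ring identities; they are transported back along `b+s≡r`.
  /+/≤ (P₂-numerator (+ r) (+ s) (+ n)) (Cᵈ₃-numerator (+ r) (+ s)) (p₃ n) (2 ℕ.* Δ₁ r s)
    (subst₂ (λ r x → P₂-numerator (+ r) (+ s) (+ n) ℤ.+ Cᵈ₃-numerator (+ r) (+ s) ℤ.≤ x) b+s≡r scale (proj₁ bounds)) ,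
  ≤/+/ (P₂-numerator (+ r) (+ s) (+ n)) (Cᵘ₃-numerator (+ r) (+ s)) (p₃ n) (2 ℕ.* Δ₁ r s)
    (subst₂ (λ r x → x ℤ.≤ P₂-numerator (+ r) (+ s) (+ n) ℤ.+ Cᵘ₃-numerator (+ r) (+ s)) b+s≡r scale (proj₂ bounds))
  where
  instance
    2Δ₁≢0 : NonZero (2 ℕ.* Δ₁ r s)
    2Δ₁≢0 = ℕ.m*n≢0 2 (Δ₁ r s) {{_}} {{Δ₁-nonZero 1≤s 2s<r}}
  b : ℕ
  b = r ℕ.∸ s
  s+s<r : s ℕ.+ s ℕ.< r
  s+s<r = subst (λ x → s ℕ.+ x ℕ.< r) (ℕ.+-identityʳ s) 2s<r
  s≤r : s ℕ.≤ r
  s≤r = ℕ.≤-trans (ℕ.m≤m+n s s) (ℕ.<⇒≤ s+s<r)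
  b+s≡r : b ℕ.+ s ≡ r
  b+s≡r = ℕ.m∸n+n≡m s≤r
  s<b : s ℕ.< b
  s<b = ℕ.m+n≤o⇒m≤o∸n (suc s) s+s<r
  bounds = numerator-bounds (s⊥r-s s≤r r⊥s)
    (subst (λ r → Coprime s (r ℕ.+ s)) (sym b+s≡r) (s⊥r+s s≤r r⊥s))
    (subst (λ r → Coprime b (r ℕ.+ s)) (sym b+s≡r) (r-s⊥r+s s≤r r⊥s 2∣s))
    1≤s s<b p₃
    (subst (λ r → δ s (δ b (δ (r ℕ.+ s) p₃)) ≗ 𝟙) (sym b+s≡r)
      λ k → trans (sym (denominator-⊛ s b (r ℕ.+ s) p₃ k)) (p₃≗1/den k))
    n
  scale : + 2 ℤ.* + s ℤ.* + b ℤ.* + (b ℕ.+ s ℕ.+ s) ℤ.* p₃ n ≡ p₃ n ℤ.* + (2 ℕ.* Δ₁ r s)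
  scale = begin
    + 2 ℤ.* + s ℤ.* + b ℤ.* + (b ℕ.+ s ℕ.+ s) ℤ.* p₃ n
      ≡⟨ cong (λ r → + 2 ℤ.* + s ℤ.* + b ℤ.* + (r ℕ.+ s) ℤ.* p₃ n) b+s≡r ⟩
    + 2 ℤ.* + s ℤ.* + b ℤ.* + (r ℕ.+ s) ℤ.* p₃ n
      ≡⟨ reorder (+ s) (+ b) (+ (r ℕ.+ s)) (p₃ n) ⟩
    p₃ n ℤ.* (+ 2 ℤ.* (+ s ℤ.* + b ℤ.* + (r ℕ.+ s)))
      ≡⟨ cong (λ x → p₃ n ℤ.* (+ 2 ℤ.* (x ℤ.* + (r ℕ.+ s)))) (ℤ.pos-* s b) ⟨
    p₃ n ℤ.* (+ 2 ℤ.* (+ (s ℕ.* b) ℤ.* + (r ℕ.+ s)))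
      ≡⟨ cong (λ x → p₃ n ℤ.* (+ 2 ℤ.* x)) (ℤ.pos-* (s ℕ.* b) (r ℕ.+ s)) ⟨
    p₃ n ℤ.* (+ 2 ℤ.* + Δ₁ r s)
      ≡⟨ cong (λ x → p₃ n ℤ.* x) (ℤ.pos-* 2 (Δ₁ r s)) ⟨
    p₃ n ℤ.* + (2 ℕ.* Δ₁ r s) ∎
    where
    open ≡-Reasoning
    reorder : ∀ s b c p → + 2 ℤ.* s ℤ.* b ℤ.* c ℤ.* p ≡ p ℤ.* (+ 2 ℤ.* (s ℤ.* b ℤ.* c))
    reorder = ℤ-Solver.solve-∀
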